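{- For any family of Boolean functions $F = \{f_n\}_{n \in \mathbb{N}}$ and any $\Delta\colon \mathbb{N} \to \mathbb{N}$, $\mathcal{L}^{\mathrm{LNBF}_{\Delta(n)}}_F(n) \in O\bigl(\max\bigl\{\frac{n^2}{2^{\Delta(n)} \log_2 n}, n\bigr\}\bigr)$. In particular, $\mathcal{L}^{\mathrm{BF}}_F(n) \in O\bigl(\frac{n^2}{\log_2 n}\bigr)$.
   Context: For an $n$-ary Boolean function $f$ and $V \subseteq [n]$, $r_V(f)$ denotes the number of distinct subfunctions of $f$ on $V$ obtained by fixing the variables outside $V$. A Nečiporuk function for a complexity measure $\mathbf{M}$ is a non-decreasing $b\colon \mathbb{N}_{>0}\to\mathbb{N}$ such that for every $n$, every $n$-ary $f$ and every partition $V_1,\dots,V_p$ of $[n]$, $\mathbf{M}(f) \ge \sum_{i=1}^p b(r_{V_i}(f))$; $\mathcal{N}_{\mathbf{M}}$ is the set of these, and $\mathcal{L}^{\mathbf{M}}_F(n) = \max\{\sum_{i=1}^p b(r_{V_i}(f_n)) \mid b \in \mathcal{N}_{\mathbf{M}},\ V_1,\dots,V_p \text{ partition of } [n]\}$. A Boolean binary formula is a binary tree whose internal nodes are labelled by arbitrary functions $\{0,1\}^2\to\{0,1\}$ and whose leaves are labelled by $0,1$ or literals $x_i,\neg x_i$; its size is the number of non-constant leaves, and $\mathrm{BF}(f)$ is the minimum size of a formula computing $f$. A $\delta$-limited nondeterministic binary formula for $f$ is a formula $\varphi'$ on $n+\delta$ variables with $f(a) = \bigvee_{b\in\{0,1\}^\delta}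 f_{\varphi'}(a,b)$; $\mathrm{LNBF}_\delta(f)$ is the minimum size of such a formula. -}

module Defs where

open import Data.Nat using (ℕ; zero; suc; _+_; _*_; _^_; _≤_)
open import Data.Bool using (Bool; true; false; _∨_; if_then_else_)
import Data.Bool as B
open import Data.Fin using (Fin; _≟_)
open import Data.Vec using (Vec; []; _∷_; _++_; zipWith; tabulate)
open import Data.List using (List; []; _∷_; map; length; deduplicate; allFin; concatMap)
open import Data.Nat.ListAction using (sum)
open import Data.List.Properties using (≡-dec)
open import Data.Product using (∃; _×_)
open import Relation.Nullary.Decidable using (⌊_⌋)
open import Relation.Binary.PropositionalEquality using (_≡_)

BoolFun : ℕ → Set
BoolFun n = Vec Bool n → Bool

allVecs : (n : ℕ) → List (Vec Bool n)
allVecs zero = [] ∷ []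
allVecs (suc n) = concatMap (λ v → (false ∷ v) ∷ (true ∷ v) ∷ []) (allVecs n)

Subset : ℕ → Set
Subset n = Vec Bool n

mergeV : ∀ {n} → Subset n → Vec Bool n → Vec Bool n → Vec Bool n
mergeV [] [] [] = []
mergeV (v ∷ V) (x ∷ xs) (r ∷ rs) = (if v then x else r) ∷ mergeV V xs rs

-- truth table of the subfunction of f on V obtained by fixing the
-- variables outside V according to ρ (the V-part of ρ is ignored)
subTable : ∀ {n} → BoolFun n → Subset n → Vec Bool n → List Bool
subTable {n} f V ρ = map (λ x → f (mergeV V x ρ)) (allVecs n)

r : ∀ {n} → BoolFun n → Subset n → ℕ
r {n} f V = length (deduplicate (≡-dec B._≟_) (map (subTable f V) (allVecs n)))

-- partitions V_1,…,V_p of [n]: each variable j gets a block c j; all blocks nonempty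
IsPartition : ∀ {n p} → (Fin n → Fin p) → Set
IsPartition {n} {p} c = (i : Fin p) → ∃ λ (j : Fin n) → c j ≡ i

block : ∀ {n p} → (Fin n → Fin p) → Fin p → Subset n
block c i = tabulate (λ j → ⌊ c j ≟ i ⌋)

necSum : ∀ {n p} → (ℕ → ℕ) → BoolFun n → (Fin n → Fin p) → ℕ
necSum {p = p} b f c = sum (map (λ i → b (r f (block c i))) (allFin p))

data Formula (n : ℕ) : Set where
  const : Bool → Formula n
  lit   : Fin n → Bool → Formula n
  gate  : (Bool → Bool → Bool) → Formula n → Formula n → Formula n

eval : ∀ {n} → Formula n → Vec Bool n → Bool
eval (const c) a = c
eval (lit i true) a = Data.Vec.lookup a i
eval (lit i false) a = B.not (Data.Vec.lookup a i)
eval (gate g φ ψ) a = g (eval φ a) (eval ψ a)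

size : ∀ {n} → Formula n → ℕ
size (const _) = 0
size (lit _ _) = 1
size (gate _ φ ψ) = size φ + size ψ

bigOr : (δ : ℕ) → (Vec Bool δ → Bool) → Bool
bigOr zero g = g []
bigOr (suc δ) g = bigOr δ (λ v → g (false ∷ v)) ∨ bigOr δ (λ v → g (true ∷ v))

Computes : ∀ {n} → Formula n → BoolFun n → Set
Computes φ f = ∀ a → f a ≡ eval φ a

NComputes : ∀ {n} (δ : ℕ) → Formula (n + δ) → BoolFun n → Set
NComputes δ φ f = ∀ a → f a ≡ bigOr δ (λ b → eval φ (a ++ b))

-- A complexity measure M is given via the relation "M(f) ≥ k".
Measure : Set₁
Measure = ∀ {n} → BoolFun n → ℕ → Set

-- BF(f) ≥ k : every formula computing f has size ≥ k (i.e. the minimum is ≥ k)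
BF≥ : Measure
BF≥ f k = ∀ φ → Computes φ f → k ≤ size φ

LNBF≥ : ℕ → Measure
LNBF≥ δ {n} f k = ∀ (φ : Formula (n + δ)) → NComputes δ φ f → k ≤ size φ

-- b : ℕ_{>0} → ℕ non-decreasing (value at 0 irrelevant)
NonDecreasing : (ℕ → ℕ) → Set
NonDecreasing b = ∀ m k → 1 ≤ m → m ≤ k → b m ≤ b k

IsNeciporuk : Measure → (ℕ → ℕ) → Set
IsNeciporuk M b = NonDecreasing b ×
  (∀ (n : ℕ) (f : BoolFun n) (p : ℕ) (c : Fin n → Fin p) → IsPartition c → M f (necSum b f c))

{-# OPTIONS --safe #-}

-- Let f(y₁,…,y_p,x) = x[y₁ ⊕ … ⊕ y_p], where the pointers yᵢ have d + e bits and the memory x has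
-- 2^(d+e) bits.  Every block yᵢ has 2^2^(d+e) subfunctions.  With d ≤ δ nondeterministic bits one
-- guesses the first d bits of the xor, checks the guess with p d leaves and needs the variables of
-- the yᵢ only to decode the last e bits, so f has a formula of size p (2·2^e + d) + O(1) as p grows
-- (reading the memory happens once).  Hence b(2^2^(d+e)) ≤ 2·2^e + d + 1 for every Nečiporuk b.
-- For a block V of size v, r_V ≤ 2^2^min(v,L) where n ≤ 2^L ≤ 2n; splitting min(v,L) = d + e
-- with d as close to δ as possible gives b(r_V)·2^δ·L ≤ v (4·2^δ·L + 2·2^L), and summing over the
-- blocks, T = Σ b(r_V) satisfies T·2^δ·L ≤ n (4·2^δ·L + 4n).  The two alternatives are 2^δ·L ≤ n and 2^δ·L ≥ n.

module Submission where

open import Defs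
open import Data.Bool using (Bool; true; false; if_then_else_; not; _∧_; _∨_; _xor_)
import Data.Bool as Bool
open import Data.Bool.Properties using (∧-conicalˡ; ∧-conicalʳ; xor-identityʳ; ∨-identityʳ; ∨-zeroʳ)
open import Data.Fin as Fin using (Fin; zero; suc; _↑ˡ_; _↑ʳ_; combine; remQuot; splitAt)
open import Data.Fin.Properties using (combine-injective; combine-surjective; injective⇒≤;
  remQuot-combine; splitAt-↑ˡ; splitAt-↑ʳ; suc-injective)
open import Data.Fin.Subset using (∣_∣)
open import Data.List as List using (List; []; _∷_)
open import Data.List.Membership.Propositional using (_∈_)
open import Data.List.Membership.Propositional.Properties
  using (∈-map⁺; ∈-map⁻; ∈-concatMap⁺; ∈-deduplicate⁺; ∈-deduplicate⁻; ∈-lookup)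
import Data.List.Properties as Listₚ
open import Data.List.Properties using (≡-dec; ∷-injectiveˡ; ∷-injectiveʳ; map-cong; map-tabulate)
open import Data.List.Relation.Unary.Any as Any using (here; there)
open import Data.List.Relation.Unary.Any.Properties using (lookup-index)
open import Data.List.Relation.Unary.Unique.DecPropositional.Properties using (deduplicate-!)
open import Data.List.Relation.Unary.AllPairs using (_∷_)
import Data.List.Relation.Unary.All as All
open import Data.List.Relation.Unary.Unique.Propositional using (Unique)
open import Data.Nat using (ℕ; zero; suc; _+_; _*_; _^_; _≤_; _⊓_; z≤n; s≤s; NonZero; >-nonZero)
open import Data.Nat.ListAction using (sum)
open import Data.Nat.Logarithm using (⌊log₂_⌋; ⌊log₂⌋-mono-≤; ⌊log₂[2^n]⌋≡n)
open import Data.Nat.Properties hiding (suc-injective)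
open import Data.Nat.Tactic.RingSolver using (solve-∀)
open import Data.Product using (_×_; ∃; _,_; proj₁; proj₂)
open import Data.Sum using (_⊎_; inj₁; inj₂; [_,_]′)
open import Data.Vec using (Vec; []; _∷_; _++_; lookup; tabulate; replicate; concat)
import Data.Vec.Functional as Vector
open import Data.Vec.Properties using (lookup-++ˡ; lookup-++ʳ; lookup-splitAt; lookup-concat;
  lookup-replicate; lookup∘tabulate; tabulate∘lookup; tabulate-cong)
open import Function using (_∘_; id)
open import Function.Definitions using (Injective)
open import Relation.Binary.PropositionalEquality
open import Relation.Nullary using (yes; no; contradiction)
open import Relation.Nullary.Decidable using (⌊_⌋; isYes≗does; dec-true)

-- Numbering of bit vectors

encode : ∀ {n} → Vec Bool n → Fin (2 ^ n)
encode [] = zero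
encode (b ∷ v) = combine {2} (if b then suc zero else zero) (encode v)

encode-injective : ∀ {n} (v w : Vec Bool n) → encode v ≡ encode w → v ≡ w
encode-injective [] [] _ = refl
encode-injective {suc n} (b ∷ v) (c ∷ w) eq
  with combine-injective {2} {2 ^ n} (if b then suc zero else zero) (encode v)
         (if c then suc zero else zero) (encode w) eq
encode-injective (false ∷ v) (false ∷ w) _ | _ , eq = cong (false ∷_) (encode-injective v w eq)
encode-injective (true ∷ v) (true ∷ w) _ | _ , eq = cong (true ∷_) (encode-injective v w eq)
encode-injective (false ∷ v) (true ∷ w) _ | () , _
encode-injective (true ∷ v) (false ∷ w) _ | () , _

encode-surjective : ∀ n (k : Fin (2 ^ n)) → ∃ λ (v : Vec Bool n) → encode v ≡ k
encode-surjective zero zero = [] , refl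
encode-surjective (suc n) k with combine-surjective {2} {2 ^ n} k
... | zero , j , refl =
  let v , eq = encode-surjective n j in false ∷ v , cong (combine {2} zero) eq
... | suc zero , j , refl =
  let v , eq = encode-surjective n j in true ∷ v , cong (combine {2} (suc zero)) eq

decode : ∀ n → Fin (2 ^ n) → Vec Bool n
decode n = proj₁ ∘ encode-surjective n

encode-decode : ∀ n (k : Fin (2 ^ n)) → encode (decode n k) ≡ k
encode-decode n = proj₂ ∘ encode-surjective n

decode-encode : ∀ {n} (v : Vec Bool n) → decode n (encode v) ≡ v
decode-encode {n} v = encode-injective (decode n (encode v)) v (encode-decode n (encode v))

lookup-extensional : ∀ {A : Set} {n} (v w : Vec A n) → (∀ i → lookup v i ≡ lookup w i) → v ≡ w
lookup-extensional v w eq = trans (sym (tabulate∘lookup v)) (trans (tabulate-cong eq) (tabulate∘lookup w))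

-- Counting distinct subfunctions

∈-allVecs : ∀ {n} (v : Vec Bool n) → v ∈ allVecs n
∈-allVecs [] = here refl
∈-allVecs (false ∷ v) = ∈-concatMap⁺ _ (Any.map (λ { refl → here refl }) (∈-allVecs v))
∈-allVecs (true ∷ v) = ∈-concatMap⁺ _ (Any.map (λ { refl → there (here refl) }) (∈-allVecs v))

map-≡⇒≡ : ∀ {A B : Set} {f g : A → B} {xs x} → List.map f xs ≡ List.map g xs → x ∈ xs → f x ≡ g x
map-≡⇒≡ eq (here refl) = ∷-injectiveˡ eq
map-≡⇒≡ eq (there x∈xs) = map-≡⇒≡ (∷-injectiveʳ eq) x∈xs

Unique⇒lookup-injective : ∀ {A : Set} {xs : List A} → Unique xs → Injective _≡_ _≡_ (List.lookup xs)
Unique⇒lookup-injective (_ ∷ _) {zero} {zero} _ = refl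
Unique⇒lookup-injective (x∉xs ∷ _) {zero} {suc j} eq = contradiction eq (All.lookup x∉xs (∈-lookup j))
Unique⇒lookup-injective (x∉xs ∷ _) {suc i} {zero} eq = contradiction (sym eq) (All.lookup x∉xs (∈-lookup i))
Unique⇒lookup-injective (_ ∷ u) {suc i} {suc j} eq = cong suc (Unique⇒lookup-injective u eq)

module _ {n} (f : BoolFun n) (V : Subset n) where

  private
    _≟ᵗ_ = ≡-dec Bool._≟_
    tables = List.map (subTable f V) (allVecs n)
    subfunctions = List.deduplicate _≟ᵗ_ tables

  subTable-≡⇒≡ : ∀ {ρ σ} → subTable f V ρ ≡ subTable f V σ →
    ∀ x → f (mergeV V x ρ) ≡ f (mergeV V x σ)
  subTable-≡⇒≡ eq x = map-≡⇒≡ eq (∈-allVecs x)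

  -- Pick for each subfunction an assignment producing it. Equal codes of two picks force equal
  -- tables, and the deduplicated list has no repetitions, so subfunctions inject into codes.
  r≤ : ∀ {m} (code : Vec Bool n → Fin m) →
    (∀ ρ σ → code ρ ≡ code σ → ∀ x → f (mergeV V x ρ) ≡ f (mergeV V x σ)) → r f V ≤ m
  r≤ code determines = injective⇒≤ injective
    where
    fixing : (i : Fin (List.length subfunctions)) → ∃ λ ρ → List.lookup subfunctions i ≡ subTable f V ρ
    fixing i with ∈-map⁻ (subTable f V) (∈-deduplicate⁻ _≟ᵗ_ tables (∈-lookup i))
    ... | ρ , _ , eq = ρ , eq

    injective : Injective _≡_ _≡_ (code ∘ proj₁ ∘ fixing)
    injective {i} {j} eq = Unique⇒lookup-injective (deduplicate-! _≟ᵗ_ tables)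
      (trans (proj₂ (fixing i)) (trans (map-cong (determines _ _ eq) (allVecs n)) (sym (proj₂ (fixing j)))))

  -- Conversely, send `i` to the position of the table of `ρ i` in the deduplicated list: equal
  -- positions mean equal tables, which separation excludes for distinct indices.
  ≤r : ∀ {m} (ρ : Fin m → Vec Bool n) →
    (∀ i j → (∀ x → f (mergeV V x (ρ i)) ≡ f (mergeV V x (ρ j))) → i ≡ j) → m ≤ r f V
  ≤r ρ separates = injective⇒≤ injective
    where
    position : ∀ i → subTable f V (ρ i) ∈ subfunctions
    position i = ∈-deduplicate⁺ _≟ᵗ_ (∈-map⁺ (subTable f V) (∈-allVecs (ρ i)))

    injective : Injective _≡_ _≡_ (Any.index ∘ position)
    injective {i} {j} eq = separates i j (subTable-≡⇒≡ (trans (lookup-index (position i))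
      (trans (cong (List.lookup subfunctions) eq) (sym (lookup-index (position j))))))

restrict : ∀ {n} (V : Subset n) → Vec Bool n → Vec Bool ∣ V ∣
restrict [] [] = []
restrict (true ∷ V) (x ∷ xs) = x ∷ restrict V xs
restrict (false ∷ V) (_ ∷ xs) = restrict V xs

-- The padding `false` outside `V` is arbitrary, because `mergeV` overwrites it.
extend : ∀ {n} (V : Subset n) → Vec Bool ∣ V ∣ → Vec Bool n
extend [] [] = []
extend (true ∷ V) (x ∷ xs) = x ∷ extend V xs
extend (false ∷ V) xs = false ∷ extend V xs

mergeV-extend-restrict : ∀ {n} (V : Subset n) x ρ → mergeV V (extend V (restrict V x)) ρ ≡ mergeV V x ρ
mergeV-extend-restrict [] [] [] = refl
mergeV-extend-restrict (true ∷ V) (x ∷ xs) (_ ∷ ρ) = cong (x ∷_) (mergeV-extend-restrict V xs ρ)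
mergeV-extend-restrict (false ∷ V) (_ ∷ xs) (y ∷ ρ) = cong (y ∷_) (mergeV-extend-restrict V xs ρ)

lookup-mergeV : ∀ {n} (V : Subset n) x ρ j →
  lookup (mergeV V x ρ) j ≡ (if lookup V j then lookup x j else lookup ρ j)
lookup-mergeV (v ∷ V) (x ∷ xs) (y ∷ ρ) zero = refl
lookup-mergeV (v ∷ V) (x ∷ xs) (y ∷ ρ) (suc j) = lookup-mergeV V xs ρ j

-- The whole assignment serves as code. This crude count is the better one for blocks with more than
-- about `log n` variables.
r≤2^n : ∀ {n} (f : BoolFun n) V → r f V ≤ 2 ^ n
r≤2^n f V = r≤ f V encode λ ρ σ eq x → cong (f ∘ mergeV V x) (encode-injective ρ σ eq)

-- The code of an assignment is the truth table, over the variables of `V` alone, of the subfunction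
-- it leaves.
r≤2^2^∣V∣ : ∀ {n} (f : BoolFun n) V → r f V ≤ 2 ^ (2 ^ ∣ V ∣)
r≤2^2^∣V∣ {n} f V = r≤ f V (encode ∘ truthTable) λ ρ σ eq x → begin
  f (mergeV V x ρ)                           ≡⟨ value ρ x ⟨
  lookup (truthTable ρ) (encode (restrict V x))
    ≡⟨ cong (λ t → lookup t (encode (restrict V x))) (encode-injective (truthTable ρ) (truthTable σ) eq) ⟩
  lookup (truthTable σ) (encode (restrict V x)) ≡⟨ value σ x ⟩
  f (mergeV V x σ)                           ∎
  where
  open ≡-Reasoning
  truthTable : Vec Bool n → Vec Bool (2 ^ ∣ V ∣)
  truthTable ρ = tabulate λ k → f (mergeV V (extend V (decode ∣ V ∣ k)) ρ)

  value : ∀ ρ x → lookup (truthTable ρ) (encode (restrict V x)) ≡ f (mergeV V x ρ)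
  value ρ x = begin
    lookup (truthTable ρ) (encode (restrict V x))
      ≡⟨ lookup∘tabulate _ (encode (restrict V x)) ⟩
    f (mergeV V (extend V (decode ∣ V ∣ (encode (restrict V x)))) ρ)
      ≡⟨ cong (λ w → f (mergeV V (extend V w) ρ)) (decode-encode (restrict V x)) ⟩
    f (mergeV V (extend V (restrict V x)) ρ)
      ≡⟨ cong f (mergeV-extend-restrict V x ρ) ⟩
    f (mergeV V x ρ)                                       ∎

-- Formula gadgets: multiplexers and iterated gates

mux : ∀ {N D} → (Fin D → Formula N) → (Vec Bool D → Formula N) → Formula N
mux {D = zero} s leaf = leaf []
mux {D = suc D} s leaf = gate _∨_
  (gate _∧_ (s zero) (mux (s ∘ suc) (leaf ∘ (true ∷_))))
  (gate (λ b c → not b ∧ c) (s zero) (mux (s ∘ suc) (leaf ∘ (false ∷_))))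

eval-mux : ∀ {N D} (s : Fin D → Formula N) (leaf : Vec Bool D → Formula N) a →
  eval (mux s leaf) a ≡ eval (leaf (tabulate λ j → eval (s j) a)) a
eval-mux {D = zero} s leaf a = refl
eval-mux {D = suc D} s leaf a
  rewrite eval-mux (s ∘ suc) (leaf ∘ (true ∷_)) a | eval-mux (s ∘ suc) (leaf ∘ (false ∷_)) a
  with eval (s zero) a
... | true = ∨-identityʳ _
... | false = refl

-- The sizes satisfy S(D+1) ≤ 2 S(D) + 2k. Adding `k + k` to both sides makes the recurrence
-- homogeneous, so each level just doubles.
size-mux : ∀ {N D} (s : Fin D → Formula N) (leaf : Vec Bool D → Formula N) {k l} →
  (∀ j → size (s j) ≤ k) → (∀ v → size (leaf v) ≤ l) →
  size (mux s leaf) + (k + k) ≤ 2 ^ D * (l + (k + k))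
size-mux {D = zero} s leaf {k} {l} s≤k leaf≤l =
  ≤-trans (+-monoˡ-≤ (k + k) (leaf≤l [])) (≤-reflexive (sym (*-identityˡ _)))
size-mux {D = suc D} s leaf {k} {l} s≤k leaf≤l = begin
  size (s zero) + m₁ + (size (s zero) + m₀) + (k + k)
    ≤⟨ +-monoˡ-≤ (k + k) (+-mono-≤ (+-monoˡ-≤ m₁ (s≤k zero)) (+-monoˡ-≤ m₀ (s≤k zero))) ⟩
  k + m₁ + (k + m₀) + (k + k)                         ≡⟨ regroup k m₁ m₀ ⟩
  (m₁ + (k + k)) + (m₀ + (k + k))
    ≤⟨ +-mono-≤ (size-mux (s ∘ suc) _ (s≤k ∘ suc) (leaf≤l ∘ (true ∷_)))
                (size-mux (s ∘ suc) _ (s≤k ∘ suc) (leaf≤l ∘ (false ∷_))) ⟩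
  2 ^ D * (l + (k + k)) + 2 ^ D * (l + (k + k))       ≡⟨ double (2 ^ D) (l + (k + k)) ⟩
  2 * 2 ^ D * (l + (k + k))                           ∎
  where
  open ≤-Reasoning
  m₁ = size (mux (s ∘ suc) (leaf ∘ (true ∷_)))
  m₀ = size (mux (s ∘ suc) (leaf ∘ (false ∷_)))

  regroup : ∀ k m n → k + m + (k + n) + (k + k) ≡ (m + (k + k)) + (n + (k + k))
  regroup = solve-∀

  double : ∀ a b → a * b + a * b ≡ 2 * a * b
  double = solve-∀

gates : ∀ {N p} → (Bool → Bool → Bool) → Bool → (Fin p → Formula N) → Formula N
gates g u = Vector.foldr (gate g) (const u)

eval-gates : ∀ {N p} g u (φs : Fin p → Formula N) a →
  eval (gates g u φs) a ≡ Vector.foldr g u (λ i → eval (φs i) a)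
eval-gates {p = zero} g u φs a = refl
eval-gates {p = suc p} g u φs a = cong (g (eval (φs zero) a)) (eval-gates g u (φs ∘ suc) a)

size-gates : ∀ {N p} g u (φs : Fin p → Formula N) {k} → (∀ i → size (φs i) ≤ k) →
  size (gates g u φs) ≤ p * k
size-gates {p = zero} g u φs φs≤k = z≤n
size-gates {p = suc p} g u φs φs≤k = +-mono-≤ (φs≤k zero) (size-gates g u (φs ∘ suc) (φs≤k ∘ suc))

-- Iterated xor and conjunction of bits

foldr-op-cong : ∀ {p} (g : Bool → Bool → Bool) {u} {v w : Fin p → Bool} → v ≗ w →
  Vector.foldr g u v ≡ Vector.foldr g u w
foldr-op-cong {zero} g eq = refl
foldr-op-cong {suc p} g eq = cong₂ g (eq zero) (foldr-op-cong g (eq ∘ suc))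

foldr-xor-false : ∀ p → Vector.foldr _xor_ false (λ (_ : Fin p) → false) ≡ false
foldr-xor-false zero = refl
foldr-xor-false (suc p) = foldr-xor-false p

foldr-xor-single : ∀ {p} (v : Fin p → Bool) i → (∀ j → j ≢ i → v j ≡ false) →
  Vector.foldr _xor_ false v ≡ v i
foldr-xor-single {suc p} v zero rest = trans
  (cong (v zero xor_) (trans (foldr-op-cong _xor_ (λ j → rest (suc j) λ ())) (foldr-xor-false p)))
  (xor-identityʳ (v zero))
foldr-xor-single v (suc i) rest rewrite rest zero (λ ()) =
  foldr-xor-single (v ∘ suc) i (λ j j≢i → rest (suc j) (j≢i ∘ suc-injective))

foldr-∧-true⇒ : ∀ {p} {v : Fin p → Bool} → Vector.foldr _∧_ true v ≡ true → ∀ i → v i ≡ true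
foldr-∧-true⇒ {v = v} eq zero = ∧-conicalˡ (v zero) _ eq
foldr-∧-true⇒ {v = v} eq (suc i) = foldr-∧-true⇒ (∧-conicalʳ (v zero) _ eq) i

foldr-∧-true⇐ : ∀ {p} {v : Fin p → Bool} → (∀ i → v i ≡ true) → Vector.foldr _∧_ true v ≡ true
foldr-∧-true⇐ {zero} eq = refl
foldr-∧-true⇐ {suc p} eq rewrite eq zero = foldr-∧-true⇐ (eq ∘ suc)

_iff_ : Bool → Bool → Bool
b iff c = not (b xor c)

iff-refl : ∀ b → b iff b ≡ true
iff-refl true = refl
iff-refl false = refl

iff⇒≡ : ∀ b c → b iff c ≡ true → b ≡ c
iff⇒≡ true true _ = refl
iff⇒≡ false false _ = refl

-- Nondeterministic guessing

bigOr-intro : ∀ δ g (b : Vec Bool δ) → g b ≡ true → bigOr δ g ≡ true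
bigOr-intro zero g [] eq = eq
bigOr-intro (suc δ) g (false ∷ b) eq rewrite bigOr-intro δ (g ∘ (false ∷_)) b eq = refl
bigOr-intro (suc δ) g (true ∷ b) eq rewrite bigOr-intro δ (g ∘ (true ∷_)) b eq = ∨-zeroʳ _

bigOr-elim : ∀ δ g → bigOr δ g ≡ true → ∃ λ b → g b ≡ true
bigOr-elim zero g eq = [] , eq
bigOr-elim (suc δ) g eq with bigOr δ (g ∘ (false ∷_)) in eq₀
... | true = let b , gb = bigOr-elim δ _ eq₀ in false ∷ b , gb
... | false = let b , gb = bigOr-elim δ _ eq in true ∷ b , gb

-- The usual correctness criterion: one guess yields the right value, and no guess accepts wrongly.
bigOr-guess : ∀ δ g {v} b → g b ≡ v → (∀ b′ → g b′ ≡ true → v ≡ true) → v ≡ bigOr δ g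
bigOr-guess δ g {true} b gb sound = sym (bigOr-intro δ g b gb)
bigOr-guess δ g {false} b gb sound with bigOr δ g in eq
... | false = refl
... | true = let b′ , gb′ = bigOr-elim δ g eq in sound b′ gb′

tabulate-+ : ∀ {A : Set} m {n} (g : Fin (m + n) → A) →
  tabulate g ≡ tabulate (g ∘ (_↑ˡ n)) ++ tabulate (g ∘ (m ↑ʳ_))
tabulate-+ zero g = refl
tabulate-+ (suc m) g = cong (g zero ∷_) (tabulate-+ m (g ∘ suc))

-- The storage access function and its many subfunctions

module Storage (p D : ℕ) where

  K n : ℕ
  K = 2 ^ D
  n = p * D + K

  pointerVar : Fin p → Fin D → Fin n
  pointerVar i j = combine i j ↑ˡ K

  cellVar : Vec Bool D → Fin n
  cellVar v = p * D ↑ʳ encode v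

  pointerXor : Vec Bool n → Fin D → Bool
  pointerXor a j = Vector.foldr _xor_ false λ i → lookup a (pointerVar i j)

  -- An indirect storage access function whose address is the xor of `p` pointers: with the other
  -- pointers zero, any single pointer reaches the whole memory.
  storage : BoolFun n
  storage a = lookup a (cellVar (tabulate (pointerXor a)))

  -- Block `zero` is the memory and block `suc i` is pointer `i`.
  owner : Fin n → Fin (suc p)
  owner t = [ (λ u → suc (proj₁ (remQuot {p} D u))) , (λ _ → zero) ]′ (splitAt (p * D) t)

  owner-pointerVar : ∀ i j → owner (pointerVar i j) ≡ suc i
  owner-pointerVar i j rewrite splitAt-↑ˡ (p * D) (combine i j) K = cong (suc ∘ proj₁) (remQuot-combine i j)

  owner-cellVar : ∀ v → owner (cellVar v) ≡ zero
  owner-cellVar v rewrite splitAt-↑ʳ (p * D) K (encode v) = refl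

  -- Pointers must have at least one bit, since otherwise their blocks would be empty.
  owner-isPartition : 1 ≤ D → IsPartition owner
  owner-isPartition 1≤D zero = cellVar (replicate D false) , owner-cellVar (replicate D false)
  owner-isPartition 1≤D (suc i) = pointerVar i (Fin.fromℕ< 1≤D) , owner-pointerVar i _

  lookup-block : ∀ {i t k} → owner t ≡ k → lookup (block owner i) t ≡ ⌊ k Fin.≟ i ⌋
  lookup-block {i} {t} refl = lookup∘tabulate _ t

  contents : Vec Bool K → Vec Bool n
  contents x = replicate (p * D) false ++ x

  -- Every pointer receives the address `u`; merging with a pointer block keeps only that block's
  -- copy.
  probe : Vec Bool D → Vec Bool n
  probe u = concat (replicate p u) ++ replicate K false

  merge-pointer : ∀ i u x i′ j → lookup (mergeV (block owner (suc i)) (probe u) (contents x)) (pointerVar i′ j)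
    ≡ (if ⌊ suc i′ Fin.≟ suc i ⌋ then lookup u j else false)
  merge-pointer i u x i′ j
    rewrite lookup-mergeV (block owner (suc i)) (probe u) (contents x) (pointerVar i′ j)
          | lookup-block {suc i} (owner-pointerVar i′ j)
          | lookup-++ˡ (concat (replicate p u)) (replicate K false) (combine i′ j)
          | lookup-++ˡ (replicate (p * D) false) x (combine i′ j)
          | lookup-concat (replicate p u) i′ j
          | lookup-replicate i′ u
          | lookup-replicate (combine i′ j) false = refl

  merge-cell : ∀ i u x v → lookup (mergeV (block owner (suc i)) (probe u) (contents x)) (cellVar v)
    ≡ lookup x (encode v)
  merge-cell i u x v
    rewrite lookup-mergeV (block owner (suc i)) (probe u) (contents x) (cellVar v)
          | lookup-block {suc i} (owner-cellVar v) = lookup-++ʳ (replicate (p * D) false) x (encode v)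

  -- Outside block `suc i` the merged input comes from `contents x`, where all pointers are zero, so
  -- the xor of the pointers is just `u`.
  storage-merge : ∀ i u x →
    storage (mergeV (block owner (suc i)) (probe u) (contents x)) ≡ lookup x (encode u)
  storage-merge i u x = trans (cong (lookup a ∘ cellVar) selected) (merge-cell i u x u)
    where
    a = mergeV (block owner (suc i)) (probe u) (contents x)

    other : ∀ j i′ → i′ ≢ i → lookup a (pointerVar i′ j) ≡ false
    other j i′ i′≢i with suc i′ Fin.≟ suc i | merge-pointer i u x i′ j
    ... | yes eq | _ = contradiction (suc-injective eq) i′≢i
    ... | no _ | eq = eq

    own : ∀ j → lookup a (pointerVar i j) ≡ lookup u j
    own j with suc i Fin.≟ suc i | merge-pointer i u x i j
    ... | yes _ | eq = eq
    ... | no ≢ | _ = contradiction refl ≢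

    selected : tabulate (pointerXor a) ≡ u
    selected = trans
      (tabulate-cong λ j → trans (foldr-xor-single _ i (other j)) (own j))
      (tabulate∘lookup u)

  -- Probing every address reads off the entire memory, so different memory contents leave different
  -- subfunctions on a pointer block.
  2^K≤r-storage : ∀ i → 2 ^ K ≤ r storage (block owner (suc i))
  2^K≤r-storage i = ≤r storage (block owner (suc i)) (contents ∘ decode K) separates
    where
    separates : ∀ s t →
      (∀ x → storage (mergeV (block owner (suc i)) x (contents (decode K s)))
           ≡ storage (mergeV (block owner (suc i)) x (contents (decode K t)))) → s ≡ t
    separates s t same = trans (sym (encode-decode K s)) (trans (cong encode decoded) (encode-decode K t))
      where
      agree : ∀ u → lookup (decode K s) (encode u) ≡ lookup (decode K t) (encode u)
      agree u = trans (sym (storage-merge i u _)) (trans (same (probe u)) (storage-merge i u _))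

      decoded : decode K s ≡ decode K t
      decoded = lookup-extensional _ _ λ k →
        subst (λ k → lookup (decode K s) k ≡ lookup (decode K t) k) (encode-decode D k) (agree (decode D k))

-- A formula with `d` guessed address bits and `g` padding bits

module GuessedStorage (p d e g : ℕ) where

  open Storage p (d + e)

  pointerF : Fin (d + e) → Fin p → Formula (n + (d + g))
  pointerF j i = lit (pointerVar i j ↑ˡ (d + g)) true

  pointerXorF : Fin (d + e) → Formula (n + (d + g))
  pointerXorF j = gates _xor_ false (pointerF j)

  guessF : Fin d → Formula (n + (d + g))
  guessF j = lit (n ↑ʳ (j ↑ˡ g)) true

  agreementF : Fin d → Formula (n + (d + g))
  agreementF j = gate _iff_ (guessF j) (pointerXorF (j ↑ˡ e))

  checkF : Formula (n + (d + g))
  checkF = gates _∧_ true agreementF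

  -- Selecting by guessed bits costs one leaf per selector, where an address bit computed from the
  -- pointers would cost `p`. This keeps the factor 2^d away from `p` in the size.
  cellF : Vec Bool e → Formula (n + (d + g))
  cellF u = mux guessF λ w → lit (cellVar (w ++ u) ↑ˡ (d + g)) true

  storageF : Formula (n + (d + g))
  storageF = gate _∧_ checkF (mux (pointerXorF ∘ (d ↑ʳ_)) cellF)

  module _ (a : Vec Bool n) where

    high : Vec Bool d
    high = tabulate λ j → pointerXor a (j ↑ˡ e)

    low : Vec Bool e
    low = tabulate λ j → pointerXor a (d ↑ʳ j)

    storage-high-low : storage a ≡ lookup a (cellVar (high ++ low))
    storage-high-low = cong (lookup a ∘ cellVar) (tabulate-+ d (pointerXor a))

    module _ (b : Vec Bool (d + g)) where

      guess : Vec Bool d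
      guess = tabulate λ j → lookup b (j ↑ˡ g)

      eval-guessF : ∀ j → eval (guessF j) (a ++ b) ≡ lookup b (j ↑ˡ g)
      eval-guessF j = lookup-++ʳ a b (j ↑ˡ g)

      eval-pointerXorF : ∀ j → eval (pointerXorF j) (a ++ b) ≡ pointerXor a j
      eval-pointerXorF j = trans (eval-gates _xor_ false (pointerF j) (a ++ b))
        (foldr-op-cong _xor_ λ i → lookup-++ˡ a b (pointerVar i j))

      eval-checkF : eval checkF (a ++ b)
        ≡ Vector.foldr _∧_ true (λ j → lookup b (j ↑ˡ g) iff pointerXor a (j ↑ˡ e))
      eval-checkF = trans (eval-gates _∧_ true agreementF (a ++ b))
        (foldr-op-cong _∧_ λ j → cong₂ _iff_ (eval-guessF j) (eval-pointerXorF (j ↑ˡ e)))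

      eval-cells : eval (mux (pointerXorF ∘ (d ↑ʳ_)) cellF) (a ++ b) ≡ lookup a (cellVar (guess ++ low))
      eval-cells = begin
        eval (mux (pointerXorF ∘ (d ↑ʳ_)) cellF) (a ++ b)
          ≡⟨ eval-mux (pointerXorF ∘ (d ↑ʳ_)) cellF (a ++ b) ⟩
        eval (cellF (tabulate λ j → eval (pointerXorF (d ↑ʳ j)) (a ++ b))) (a ++ b)
          ≡⟨ cong (λ u → eval (cellF u) (a ++ b)) (tabulate-cong (eval-pointerXorF ∘ (d ↑ʳ_))) ⟩
        eval (cellF low) (a ++ b)
          ≡⟨ eval-mux guessF _ (a ++ b) ⟩
        lookup (a ++ b) (cellVar ((tabulate λ j → eval (guessF j) (a ++ b)) ++ low) ↑ˡ (d + g))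
          ≡⟨ lookup-++ˡ a b _ ⟩
        lookup a (cellVar ((tabulate λ j → eval (guessF j) (a ++ b)) ++ low))
          ≡⟨ cong (λ w → lookup a (cellVar (w ++ low))) (tabulate-cong eval-guessF) ⟩
        lookup a (cellVar (guess ++ low)) ∎
        where open ≡-Reasoning

      -- Passing the check forces the guess to agree with the high address bits, so the cell that
      -- was read is the addressed one.
      eval-storageF-sound : eval storageF (a ++ b) ≡ true → storage a ≡ true
      eval-storageF-sound accepted = begin
        storage a                          ≡⟨ storage-high-low ⟩
        lookup a (cellVar (high ++ low))   ≡⟨ cong (λ w → lookup a (cellVar (w ++ low))) (tabulate-cong guessed) ⟨
        lookup a (cellVar (guess ++ low))  ≡⟨ eval-cells ⟨
        eval (mux (pointerXorF ∘ (d ↑ʳ_)) cellF) (a ++ b)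
          ≡⟨ ∧-conicalʳ (eval checkF (a ++ b)) _ accepted ⟩
        true                               ∎
        where
        open ≡-Reasoning
        guessed : ∀ j → lookup b (j ↑ˡ g) ≡ pointerXor a (j ↑ˡ e)
        guessed j = iff⇒≡ _ _ (foldr-∧-true⇒
          (trans (sym eval-checkF) (∧-conicalˡ (eval checkF (a ++ b)) _ accepted)) j)

    rightGuess : Vec Bool (d + g)
    rightGuess = high ++ replicate g false

    lookup-rightGuess : ∀ j → lookup rightGuess (j ↑ˡ g) ≡ pointerXor a (j ↑ˡ e)
    lookup-rightGuess j = trans (lookup-++ˡ high (replicate g false) j) (lookup∘tabulate _ j)

    eval-storageF-rightGuess : eval storageF (a ++ rightGuess) ≡ storage a
    eval-storageF-rightGuess = begin
      eval checkF (a ++ rightGuess) ∧ eval (mux (pointerXorF ∘ (d ↑ʳ_)) cellF) (a ++ rightGuess)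
        ≡⟨ cong₂ _∧_ passes (eval-cells rightGuess) ⟩
      lookup a (cellVar (guess rightGuess ++ low))
        ≡⟨ cong (λ w → lookup a (cellVar (w ++ low))) (tabulate-cong lookup-rightGuess) ⟩
      lookup a (cellVar (high ++ low))
        ≡⟨ storage-high-low ⟨
      storage a ∎
      where
      open ≡-Reasoning
      passes : eval checkF (a ++ rightGuess) ≡ true
      passes = trans (eval-checkF rightGuess) (foldr-∧-true⇐ λ j →
        trans (cong (_iff pointerXor a (j ↑ˡ e)) (lookup-rightGuess j)) (iff-refl (pointerXor a (j ↑ˡ e))))

  storageF-computes : NComputes (d + g) storageF storage
  storageF-computes a = bigOr-guess (d + g) _ (rightGuess a) (eval-storageF-rightGuess a) (eval-storageF-sound a)

  size-storageF : size storageF ≤ d * (1 + p) + 2 ^ e * (2 ^ d * 3 + (p + p))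
  size-storageF = +-mono-≤
    (size-gates _∧_ true agreementF λ j → +-monoʳ-≤ 1 (size-pointerXorF (j ↑ˡ e)))
    -- The outer multiplexer has selectors of size at most `p`. Its leaves are multiplexers with
    -- selectors and leaves of size 1, hence of size at most 2^d times 1 + 2 = 3.
    (m+n≤o⇒m≤o _ (size-mux (pointerXorF ∘ (d ↑ʳ_)) cellF (size-pointerXorF ∘ (d ↑ʳ_))
      λ u → m+n≤o⇒m≤o _ (size-mux guessF _ {1} {1} (λ _ → ≤-refl) (λ _ → ≤-refl))))
    where
    size-pointerXorF : ∀ j → size (pointerXorF j) ≤ p
    size-pointerXorF j = ≤-trans (size-gates _xor_ false (pointerF j) (λ _ → ≤-refl)) (≤-reflexive (*-identityʳ p))

-- Upper bound on the values of a Nečiporuk function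

sum-tabulate-≥ : ∀ {p m} (h : Fin p → ℕ) → (∀ i → m ≤ h i) → p * m ≤ sum (List.tabulate h)
sum-tabulate-≥ {zero} h m≤h = z≤n
sum-tabulate-≥ {suc p} h m≤h = +-mono-≤ (m≤h zero) (sum-tabulate-≥ (h ∘ suc) (m≤h ∘ suc))

sum-tabulate-*-mono : ∀ {p} (h v : Fin p → ℕ) {A B} → (∀ i → h i * A ≤ v i * B) →
  sum (List.tabulate h) * A ≤ sum (List.tabulate v) * B
sum-tabulate-*-mono {zero} h v h≤v = z≤n
sum-tabulate-*-mono {suc p} h v {A} {B} h≤v
  rewrite *-distribʳ-+ A (h zero) (sum (List.tabulate (h ∘ suc)))
        | *-distribʳ-+ B (v zero) (sum (List.tabulate (v ∘ suc))) =
  +-mono-≤ (h≤v zero) (sum-tabulate-*-mono (h ∘ suc) (v ∘ suc) (h≤v ∘ suc))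

necSum-tabulate : ∀ {n p} b (f : BoolFun n) (c : Fin n → Fin p) →
  necSum b f c ≡ sum (List.tabulate λ i → b (r f (block c i)))
necSum-tabulate b f c = cong sum (map-tabulate id (λ i → b (r f (block c i))))

-- The number p of pointers is the part of the formula size that does not grow with p, so that
-- this part costs only 1 after division by p.
neciporuk-upperBound : ∀ d e g {b} → IsNeciporuk (LNBF≥ (d + g)) b → 1 ≤ d + e →
  b (2 ^ (2 ^ (d + e))) ≤ suc d + 2 * 2 ^ e
neciporuk-upperBound d e g {b} (mono , bounds) 1≤D = *-cancelˡ-≤ p (begin
  p * b (2 ^ K)
    ≤⟨ sum-tabulate-≥ _ (λ i → mono _ _ (m^n>0 2 K) (2^K≤r-storage i)) ⟩
  sum (List.tabulate λ i → b (r storage (block owner (suc i))))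
    ≤⟨ m≤n+m _ (b (r storage (block owner zero))) ⟩
  sum (List.tabulate λ i → b (r storage (block owner i))) ≡⟨ necSum-tabulate b storage owner ⟨
  necSum b storage owner
    ≤⟨ bounds n storage (suc p) owner (owner-isPartition 1≤D) storageF storageF-computes ⟩
  size storageF                             ≤⟨ size-storageF ⟩
  d * (1 + p) + 2 ^ e * (2 ^ d * 3 + (p + p)) ≡⟨ regroup d (2 ^ e) (2 ^ d) p ⟩
  (d + 2 ^ e * (2 ^ d * 3)) + p * (d + 2 * 2 ^ e) ≡⟨ *-suc p (d + 2 * 2 ^ e) ⟨
  p * (suc d + 2 * 2 ^ e)                   ∎)
  where
  p = d + 2 ^ e * (2 ^ d * 3)
  open Storage p (d + e)
  open GuessedStorage p d e g
  open ≤-Reasoning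
  instance
    p≢0 : NonZero p
    p≢0 = >-nonZero (≤-trans (*-mono-≤ (m^n>0 2 e) (*-mono-≤ (m^n>0 2 d) (s≤s {0} {2} z≤n))) (m≤n+m _ d))

  regroup : ∀ d s t p → d * (1 + p) + s * (t * 3 + (p + p)) ≡ (d + s * (t * 3)) + p * (d + 2 * s)
  regroup = solve-∀

-- Block sizes of a partition

sum-tabulate-cong : ∀ {p} {g h : Fin p → ℕ} → g ≗ h → sum (List.tabulate g) ≡ sum (List.tabulate h)
sum-tabulate-cong = cong sum ∘ Listₚ.tabulate-cong

sum-tabulate-+ : ∀ {p} (g h : Fin p → ℕ) →
  sum (List.tabulate λ i → g i + h i) ≡ sum (List.tabulate g) + sum (List.tabulate h)
sum-tabulate-+ {zero} g h = refl
sum-tabulate-+ {suc p} g h = trans (cong (g zero + h zero +_) (sum-tabulate-+ (g ∘ suc) (h ∘ suc)))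
  (interchange (g zero) (h zero) _ _)
  where
  interchange : ∀ a b c d → a + b + (c + d) ≡ a + c + (b + d)
  interchange = solve-∀

sum-tabulate-0 : ∀ p → sum (List.tabulate λ (_ : Fin p) → 0) ≡ 0
sum-tabulate-0 zero = refl
sum-tabulate-0 (suc p) = sum-tabulate-0 p

sum-tabulate-indicator : ∀ {p} (j : Fin p) →
  sum (List.tabulate λ i → if ⌊ j Fin.≟ i ⌋ then 1 else 0) ≡ 1
sum-tabulate-indicator {suc p} zero = cong suc (sum-tabulate-0 p)
sum-tabulate-indicator (suc j) = trans
  (sum-tabulate-cong λ i → cong (if_then 1 else 0)
    (trans (isYes≗does (suc j Fin.≟ suc i)) (sym (isYes≗does (j Fin.≟ i)))))
  (sum-tabulate-indicator j)

∣∷∣ : ∀ {n} b (V : Subset n) → ∣ b ∷ V ∣ ≡ (if b then 1 else 0) + ∣ V ∣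
∣∷∣ true V = refl
∣∷∣ false V = refl

-- Induction on `n`: the first variable adds 1 to exactly one block.
sum-∣block∣ : ∀ {n p} (c : Fin n → Fin p) → sum (List.tabulate λ i → ∣ block c i ∣) ≡ n
sum-∣block∣ {zero} {p} c = sum-tabulate-0 p
sum-∣block∣ {suc n} c = begin
  sum (List.tabulate λ i → ∣ block c i ∣)
    ≡⟨ sum-tabulate-cong (λ i → ∣∷∣ ⌊ c zero Fin.≟ i ⌋ (block (c ∘ suc) i)) ⟩
  sum (List.tabulate λ i → (if ⌊ c zero Fin.≟ i ⌋ then 1 else 0) + ∣ block (c ∘ suc) i ∣)
    ≡⟨ sum-tabulate-+ (λ i → if ⌊ c zero Fin.≟ i ⌋ then 1 else 0) _ ⟩
  sum (List.tabulate λ i → if ⌊ c zero Fin.≟ i ⌋ then 1 else 0) + sum (List.tabulate λ i → ∣ block (c ∘ suc) i ∣)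
    ≡⟨ cong₂ _+_ (sum-tabulate-indicator (c zero)) (sum-∣block∣ (c ∘ suc)) ⟩
  suc n ∎
  where open ≡-Reasoning

lookup-true⇒1≤∣∣ : ∀ {n} (V : Subset n) j → lookup V j ≡ true → 1 ≤ ∣ V ∣
lookup-true⇒1≤∣∣ (true ∷ V) _ _ = s≤s z≤n
lookup-true⇒1≤∣∣ (false ∷ V) (suc j) eq = lookup-true⇒1≤∣∣ V j eq

1≤∣block∣ : ∀ {n p} (c : Fin n → Fin p) → IsPartition c → ∀ i → 1 ≤ ∣ block c i ∣
1≤∣block∣ c nonempty i with nonempty i
... | j , refl = lookup-true⇒1≤∣∣ (block c (c j)) j (trans (lookup∘tabulate _ j)
  (trans (isYes≗does (c j Fin.≟ c j)) (dec-true (c j Fin.≟ c j) refl)))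

-- Estimates for powers of two

suc-n≤2^n : ∀ n → suc n ≤ 2 ^ n
suc-n≤2^n zero = ≤-refl
suc-n≤2^n (suc n) = begin
  suc (suc n)         ≤⟨ +-mono-≤ (m^n>0 2 n) (suc-n≤2^n n) ⟩
  2 ^ n + 2 ^ n       ≡⟨ cong (2 ^ n +_) (+-identityʳ (2 ^ n)) ⟨
  2 ^ suc n           ∎
  where open ≤-Reasoning

-- That 2^x / x is non-decreasing on positive integers, cleared of denominators. With `n = m + k`,
-- use m + k ≤ (k + 1) m ≤ 2^k m.
2^m*n≤2^n*m : ∀ {m n} → 1 ≤ m → m ≤ n → 2 ^ m * n ≤ 2 ^ n * m
2^m*n≤2^n*m {m} {n} 1≤m m≤n with m≤n⇒∃[o]m+o≡n m≤n
... | k , refl = begin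
  2 ^ m * (m + k)      ≤⟨ *-monoʳ-≤ (2 ^ m) (+-monoʳ-≤ m (m≤m*n k m {{>-nonZero 1≤m}})) ⟩
  2 ^ m * (suc k * m)  ≤⟨ *-monoʳ-≤ (2 ^ m) (*-monoˡ-≤ m (suc-n≤2^n k)) ⟩
  2 ^ m * (2 ^ k * m)  ≡⟨ *-assoc (2 ^ m) (2 ^ k) m ⟨
  2 ^ m * 2 ^ k * m    ≡⟨ cong (_* m) (^-distribˡ-+-* 2 m k) ⟨
  2 ^ (m + k) * m      ∎
  where open ≤-Reasoning

2^-approximation : ∀ n → 1 ≤ n → ∃ λ L → 1 ≤ L × n ≤ 2 ^ L × 2 ^ L ≤ 2 * n
-- Taking `L = 1` rather than 0 keeps `L` positive, as the later division by it requires.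
2^-approximation 1 _ = 1 , ≤-refl , s≤s z≤n , ≤-refl
2^-approximation (suc (suc n)) _ with 2^-approximation (suc n) (s≤s z≤n)
... | L , 1≤L , lo , hi with suc (suc n) ≤? 2 ^ L
...   | yes lo′ = L , 1≤L , lo′ , ≤-trans hi (*-monoʳ-≤ 2 (n≤1+n (suc n)))
-- `L` grows only when 2^L falls below the new number, so the doubled power is at most twice that
-- number.
...   | no ≰ = suc L , s≤s z≤n
  , ≤-trans (+-mono-≤ (m^n>0 2 L) lo) (≤-reflexive (cong (2 ^ L +_) (sym (+-identityʳ (2 ^ L)))))
  , *-monoʳ-≤ 2 (<⇒≤ (≰⇒> ≰))

-- From one block to the whole partition

1≤r : ∀ {n} (f : BoolFun n) V → 1 ≤ r f V
1≤r {n} f V = ≤r f V {1} (λ _ → replicate n false) λ { zero zero _ → refl }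

r≤2^2^⊓ : ∀ {n L} (f : BoolFun n) V → n ≤ 2 ^ L → r f V ≤ 2 ^ (2 ^ (∣ V ∣ ⊓ L))
r≤2^2^⊓ {n} {L} f V n≤2^L with ⊓-sel ∣ V ∣ L
... | inj₁ eq rewrite eq = r≤2^2^∣V∣ f V
... | inj₂ eq rewrite eq = ≤-trans (r≤2^n f V) (^-monoʳ-≤ 2 n≤2^L)

module _ {δ b} (neciporuk : IsNeciporuk (LNBF≥ δ) b) where

  private
    bound : ∀ d e → d ≤ δ → 1 ≤ d + e → b (2 ^ (2 ^ (d + e))) ≤ suc d + 2 * 2 ^ e
    bound d e d≤δ 1≤D with m≤n⇒∃[o]m+o≡n d≤δ
    ... | g , refl = neciporuk-upperBound d e g neciporuk 1≤D

  -- Monotonicity of `b` replaces `r f V` by a value that the storage function controls. The right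
  -- side is linear in the block size, so that summing over a partition yields `n`.
  block-bound : ∀ {n L} (f : BoolFun n) V → 1 ≤ ∣ V ∣ → 1 ≤ L → n ≤ 2 ^ L →
    b (r f V) * (2 ^ δ * L) ≤ ∣ V ∣ * (4 * (2 ^ δ * L) + 2 * 2 ^ L)
  block-bound {n} {L} f V 1≤v 1≤L n≤2^L = ≤-trans
    (*-monoˡ-≤ (2 ^ δ * L) (proj₁ neciporuk _ _ (1≤r f V) (r≤2^2^⊓ f V n≤2^L)))
    (cases (≤-total q δ))
    where
    open ≤-Reasoning
    v = ∣ V ∣
    q = v ⊓ L

    1≤q : 1 ≤ q
    1≤q = ⊓-glb 1≤v 1≤L

    q≤v : q ≤ v
    q≤v = m⊓n≤m v L

    -- For v ≤ L this is the monotonicity of 2^x / x; for v ≥ L the minimum is `L` itself.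
    2^q*L≤2^L*v : 2 ^ q * L ≤ 2 ^ L * v
    2^q*L≤2^L*v with ≤-total v L
    ... | inj₁ v≤L rewrite m≤n⇒m⊓n≡m v≤L = 2^m*n≤2^n*m 1≤v v≤L
    ... | inj₂ L≤v rewrite m≥n⇒m⊓n≡n L≤v = *-monoʳ-≤ (2 ^ L) L≤v

    cases : q ≤ δ ⊎ δ ≤ q → b (2 ^ (2 ^ q)) * (2 ^ δ * L) ≤ v * (4 * (2 ^ δ * L) + 2 * 2 ^ L)
    -- There are enough guess bits for the whole address: d = q and e = 0 give q + 3 ≤ 4v.
    cases (inj₁ q≤δ) = begin
      b (2 ^ (2 ^ q)) * A       ≡⟨ cong (λ k → b (2 ^ (2 ^ k)) * A) (+-identityʳ q) ⟨
      b (2 ^ (2 ^ (q + 0))) * A ≤⟨ *-monoˡ-≤ A (bound q 0 q≤δ (m≤n⇒m≤n+o 0 1≤q)) ⟩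
      (suc q + 2) * A           ≤⟨ *-monoˡ-≤ A (+-mono-≤ (+-mono-≤ 1≤v q≤v) (*-monoʳ-≤ 2 1≤v)) ⟩
      (v + v + 2 * v) * A       ≡⟨ regroup v A ⟩
      v * (4 * A)               ≤⟨ *-monoʳ-≤ v (m≤m+n (4 * A) (2 * 2 ^ L)) ⟩
      v * (4 * A + 2 * 2 ^ L)   ∎
      where
      A = 2 ^ δ * L
      regroup : ∀ v A → (v + v + 2 * v) * A ≡ v * (4 * A)
      regroup = solve-∀
    -- All δ guess bits are spent, leaving e = q - δ bits to decode. The factor 2^δ on the left
    -- turns 2^e into 2^q.
    cases (inj₂ δ≤q) with m≤n⇒∃[o]m+o≡n δ≤q
    ... | e , δ+e≡q = begin
      b (2 ^ (2 ^ q)) * A                ≡⟨ cong (λ k → b (2 ^ (2 ^ k)) * A) δ+e≡q ⟨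
      b (2 ^ (2 ^ (δ + e))) * A
        ≤⟨ *-monoˡ-≤ A (bound δ e ≤-refl (subst (1 ≤_) (sym δ+e≡q) 1≤q)) ⟩
      (suc δ + 2 * 2 ^ e) * A
        ≤⟨ *-monoˡ-≤ A (+-monoˡ-≤ (2 * 2 ^ e) (+-mono-≤ 1≤v (≤-trans δ≤q q≤v))) ⟩
      (v + v + 2 * 2 ^ e) * A            ≡⟨ regroup v (2 ^ e) (2 ^ δ) L ⟩
      2 * v * A + 2 * (2 ^ δ * 2 ^ e * L)
        ≡⟨ cong (λ k → 2 * v * A + 2 * (k * L)) (trans (sym (^-distribˡ-+-* 2 δ e)) (cong (2 ^_) δ+e≡q)) ⟩
      2 * v * A + 2 * (2 ^ q * L)
        ≤⟨ +-mono-≤ (*-monoˡ-≤ A (*-monoˡ-≤ v (s≤s (s≤s (z≤n {2}))))) (*-monoʳ-≤ 2 2^q*L≤2^L*v) ⟩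
      4 * v * A + 2 * (2 ^ L * v)        ≡⟨ regroup′ v A (2 ^ L) ⟩
      v * (4 * A + 2 * 2 ^ L)            ∎
      where
      A = 2 ^ δ * L
      regroup : ∀ v s t L → (v + v + 2 * s) * (t * L) ≡ 2 * v * (t * L) + 2 * (t * s * L)
      regroup = solve-∀
      regroup′ : ∀ v A t → 4 * v * A + 2 * (t * v) ≡ v * (4 * A + 2 * t)
      regroup′ = solve-∀

  necSum-bound : ∀ {n L p} (f : BoolFun n) (c : Fin n → Fin p) → IsPartition c →
    1 ≤ L → n ≤ 2 ^ L → necSum b f c * (2 ^ δ * L) ≤ n * (4 * (2 ^ δ * L) + 2 * 2 ^ L)
  necSum-bound {n} {L} f c isPartition 1≤L n≤2^L = begin
    necSum b f c * A
      ≡⟨ cong (_* A) (necSum-tabulate b f c) ⟩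
    sum (List.tabulate λ i → b (r f (block c i))) * A
      ≤⟨ sum-tabulate-*-mono _ _ (λ i → block-bound f (block c i) (1≤∣block∣ c isPartition i) 1≤L n≤2^L) ⟩
    sum (List.tabulate λ i → ∣ block c i ∣) * (4 * A + 2 * 2 ^ L)
      ≡⟨ cong (_* (4 * A + 2 * 2 ^ L)) (sum-∣block∣ c) ⟩
    n * (4 * A + 2 * 2 ^ L)                                   ∎
    where
    open ≤-Reasoning
    A = 2 ^ δ * L

  -- `L` is a rounded-up logarithm: it can be replaced by `⌊log₂ n ⌋` on the left of the bound, and
  -- L < 2^L ≤ 2n keeps it linear where no case distinction is made.
  necSum-LNBF : ∀ {n p} (f : BoolFun n) (c : Fin n → Fin p) → 1 ≤ n → IsPartition c →
    ∃ λ L → 1 ≤ L × ⌊log₂ n ⌋ ≤ L × L ≤ 2 * n ×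
      necSum b f c * (2 ^ δ * L) ≤ n * (4 * (2 ^ δ * L) + 4 * n)
  necSum-LNBF {n} f c 1≤n isPartition with 2^-approximation n 1≤n
  ... | L , 1≤L , n≤2^L , 2^L≤2n = L , 1≤L
    , ≤-trans (⌊log₂⌋-mono-≤ n≤2^L) (≤-reflexive (⌊log₂[2^n]⌋≡n L))
    , ≤-trans (<⇒≤ (suc-n≤2^n L)) 2^L≤2n
    , ≤-trans (necSum-bound f c isPartition 1≤L n≤2^L)
        (*-monoʳ-≤ n (+-monoʳ-≤ (4 * (2 ^ δ * L))
          (≤-trans (*-monoʳ-≤ 2 2^L≤2n) (≤-reflexive (sym (*-assoc 2 2 n))))))

-- Deterministic formulas as formulas with no guess bits

renameF : ∀ {m n} → (Fin m → Fin n) → Formula m → Formula n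
renameF σ (const c) = const c
renameF σ (lit i s) = lit (σ i) s
renameF σ (gate g φ ψ) = gate g (renameF σ φ) (renameF σ ψ)

size-renameF : ∀ {m n} (σ : Fin m → Fin n) φ → size (renameF σ φ) ≡ size φ
size-renameF σ (const c) = refl
size-renameF σ (lit i s) = refl
size-renameF σ (gate g φ ψ) = cong₂ _+_ (size-renameF σ φ) (size-renameF σ ψ)

eval-renameF : ∀ {m n} (σ : Fin m → Fin n) a a′ → (∀ i → lookup a i ≡ lookup a′ (σ i)) →
  ∀ φ → eval φ a ≡ eval (renameF σ φ) a′
eval-renameF σ a a′ eq (const c) = refl
eval-renameF σ a a′ eq (lit i true) = eq i
eval-renameF σ a a′ eq (lit i false) = cong not (eq i)
eval-renameF σ a a′ eq (gate g φ ψ) = cong₂ g (eval-renameF σ a a′ eq φ) (eval-renameF σ a a′ eq ψ)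

-- A formula without guess bits is an ordinary one up to renaming the variables of `n + 0`, so every
-- Nečiporuk function for BF is one for LNBF with δ = 0.
BF≥⇒LNBF≥0 : ∀ {n} {f : BoolFun n} {k} → BF≥ f k → LNBF≥ 0 f k
BF≥⇒LNBF≥0 {n} bf φ computes = subst (_ ≤_) (size-renameF σ φ)
  (bf (renameF σ φ) λ a → trans (computes a) (eval-renameF σ (a ++ []) a (agree a) φ))
  where
  σ : Fin (n + 0) → Fin n
  σ i = [ id , (λ ()) ]′ (splitAt n i)

  agree : ∀ a i → lookup (a ++ []) i ≡ lookup a (σ i)
  agree a i with splitAt n i | lookup-splitAt n a [] i
  ... | inj₁ _ | eq = eq

-- Asymptotic form of the bounds

theorem8p4 : (F : (n : ℕ) → BoolFun n) →
    ((Δ : ℕ → ℕ) → ∃ λ C → ∃ λ N₀ → ∀ n → N₀ ≤ n →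
    ∀ b → IsNeciporuk (LNBF≥ (Δ n)) b → ∀ p (c : Fin n → Fin p) → IsPartition c →
    (necSum b (F n) c * 2 ^ Δ n * ⌊log₂ n ⌋ ≤ C * n ^ 2) ⊎ (necSum b (F n) c ≤ C * n))
    × (∃ λ C → ∃ λ N₀ → ∀ n → N₀ ≤ n →
    ∀ b → IsNeciporuk BF≥ b → ∀ p (c : Fin n → Fin p) → IsPartition c →
    necSum b (F n) c * ⌊log₂ n ⌋ ≤ C * n ^ 2)
theorem8p4 F = (λ Δ → 8 , 1 , nondeterministic Δ) , (12 , 1 , deterministic)
  where
  open ≤-Reasoning

  -- Here `k` is a bound for 2^δ L / n: it is 1 in the first alternative and 2 for BF, whence the
  -- constants 8 and 12.
  collect : ∀ k n → n * (4 * (k * n) + 4 * n) ≡ (4 * k + 4) * (n ^ 2)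
  collect k n = trans (ring k n) (cong (λ m → (4 * k + 4) * (n * m)) (sym (*-identityʳ n)))
    where
    ring : ∀ k n → n * (4 * (k * n) + 4 * n) ≡ (4 * k + 4) * (n * n)
    ring = solve-∀

  nondeterministic : ∀ Δ n → 1 ≤ n → ∀ b → IsNeciporuk (LNBF≥ (Δ n)) b →
    ∀ p (c : Fin n → Fin p) → IsPartition c →
    (necSum b (F n) c * 2 ^ Δ n * ⌊log₂ n ⌋ ≤ 8 * n ^ 2) ⊎ (necSum b (F n) c ≤ 8 * n)
  nondeterministic Δ n 1≤n b neciporuk p c isPartition
    with necSum-LNBF neciporuk (F n) c 1≤n isPartition
  ... | L , 1≤L , log≤L , _ , bound with ≤-total (2 ^ Δ n * L) n
  ...   | inj₁ A≤n = inj₁ (begin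
    T * 2 ^ Δ n * ⌊log₂ n ⌋         ≤⟨ *-monoʳ-≤ (T * 2 ^ Δ n) log≤L ⟩
    T * 2 ^ Δ n * L                 ≡⟨ *-assoc T (2 ^ Δ n) L ⟩
    T * (2 ^ Δ n * L)               ≤⟨ bound ⟩
    n * (4 * (2 ^ Δ n * L) + 4 * n)
      ≤⟨ *-monoʳ-≤ n (+-monoˡ-≤ (4 * n) (*-monoʳ-≤ 4 (≤-trans A≤n (≤-reflexive (sym (*-identityˡ n)))))) ⟩
    n * (4 * (1 * n) + 4 * n)       ≡⟨ collect 1 n ⟩
    8 * n ^ 2                       ∎)
    where T = necSum b (F n) c
  -- Now the linear term dominates: `n` is replaced by `A` inside the bracket and the positive
  -- factor `A` cancels.
  ...   | inj₂ n≤A = inj₂ (*-cancelʳ-≤ T (8 * n) A {{>-nonZero (*-mono-≤ (m^n>0 2 (Δ n)) 1≤L)}} (begin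
    T * A                 ≤⟨ bound ⟩
    n * (4 * A + 4 * n)   ≤⟨ *-monoʳ-≤ n (+-monoʳ-≤ (4 * A) (*-monoʳ-≤ 4 n≤A)) ⟩
    n * (4 * A + 4 * A)   ≡⟨ ring n A ⟩
    8 * n * A             ∎))
    where
    T = necSum b (F n) c
    A = 2 ^ Δ n * L
    ring : ∀ n A → n * (4 * A + 4 * A) ≡ 8 * n * A
    ring = solve-∀

  deterministic : ∀ n → 1 ≤ n → ∀ b → IsNeciporuk BF≥ b →
    ∀ p (c : Fin n → Fin p) → IsPartition c → necSum b (F n) c * ⌊log₂ n ⌋ ≤ 12 * n ^ 2
  deterministic n 1≤n b (mono , bounds) p c isPartition
    with necSum-LNBF {0} (mono , λ n f p c part → BF≥⇒LNBF≥0 (bounds n f p c part)) (F n) c 1≤n isPartition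
  ... | L , _ , log≤L , L≤2n , bound = begin
    T * ⌊log₂ n ⌋             ≤⟨ *-monoʳ-≤ T (≤-trans log≤L (≤-reflexive (sym (*-identityˡ L)))) ⟩
    T * (1 * L)               ≤⟨ bound ⟩
    n * (4 * (1 * L) + 4 * n)
      -- With δ = 0 the estimate L ≤ 2n puts both terms below a multiple of n², so a single
      -- alternative remains.
      ≤⟨ *-monoʳ-≤ n (+-monoˡ-≤ (4 * n) (*-monoʳ-≤ 4 (≤-trans (≤-reflexive (*-identityˡ L)) L≤2n))) ⟩
    n * (4 * (2 * n) + 4 * n) ≡⟨ collect 2 n ⟩
    12 * n ^ 2                ∎
    where T = necSum b (F n) c
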